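{- Let $\mathcal{A}$ be a nonempty upward closed collection of Turing degrees with a countable (finite or countably infinite) basis $\mathcal{B}$. Then there is a pair $(R,S)$ of equivalence relations on $\omega$, neither of which has an infinite equivalence class, such that $\mathrm{DgSp}_{\Leftrightarrow}(R,S)=\mathcal{A}$.
   Context: For equivalence relations $R,S$ on $\omega$ and a Turing degree $\mathbf{d}$, write $R\leq_{\mathbf{d}} S$ if there is a $\mathbf{d}$-computable function $f:\omega\to\omega$ such that for all $x,y\in\omega$, $x R y \Leftrightarrow f(x) S f(y)$; write $R\equiv_{\mathbf{d}} S$ if $R\leq_{\mathbf{d}} S$ and $S\leq_{\mathbf{d}} R$. The bi-reducibility spectrum of $(R,S)$ is $\mathrm{DgSp}_{\Leftrightarrow}(R,S)=\{\mathbf{d} : R\equiv_{\mathbf{d}} S\}$. A collection $\mathcal{A}$ of Turing degrees is upward closed if $\mathbf{a}\in\mathcal{A}$ and $\mathbf{a}\leq\mathbf{d}$ imply $\mathbf{d}\in\mathcal{A}$. A set $\mathcal{B}$ of Turing degrees is a basis of $\mathcal{A}$ if (1) the elements of $\mathcal{B}$ are pairwise Turing-incomparable, and (2) $\mathcal{A}=\{\mathbf{d} : (\exists \mathbf{b}\in\mathcal{B})(\mathbf{b}\leq\mathbf{d})\}$. -}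

module Defs where

open import Data.Bool.Base using (Bool; if_then_else_)
open import Data.Fin.Base using (Fin)
open import Data.Nat.Base using (ℕ; suc; _<_)
open import Data.Nat.InfinitelyOften using (Inf)
open import Data.Product using (Σ; ∃; _×_; _,_; proj₁; proj₂)
open import Data.Sum.Base using (_⊎_)
open import Data.Vec.Base using (Vec; []; _∷_; lookup)
open import Data.Vec.Relation.Binary.Pointwise.Inductive
  using (Pointwise; []; _∷_)
open import Function.Base using (_on_)
open import Function.Bundles using (_⇔_)
open import Function.Definitions using (Bijective)
open import Level using (Level; 0ℓ)
open import Relation.Binary.Core using (Rel)
open import Relation.Binary.Definitions using (_Respects_)
open import Relation.Binary.PropositionalEquality.Core using (_≡_)
open import Relation.Nullary.Negation.Core using (¬_)
open import Relation.Unary using (Pred; _∈_; _≐_)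

private
  variable
    m n : ℕ
    ℓ ℓ′ : Level

-- A subset of ω, given by its characteristic function.
Oracle : Set
Oracle = ℕ → Bool

χ : Oracle → ℕ → ℕ
χ A x = if A x then 1 else 0

-- Kleene's relativised partial recursive functions: the index is the arity,
-- and `orc` is the characteristic function of the oracle.
data Code : ℕ → Set where
  zer  : Code n
  succ : Code 1
  proj : Fin n → Code n
  orc  : Code 1
  comp : Code m → Vec (Code n) m → Code n
  prec : Code n → Code (suc (suc n)) → Code (suc n)
  mu   : Code (suc n) → Code n

-- `Eval A p xs y`: with oracle A, program p halts on input xs with output y.
-- In `prec` the recursion argument comes first, and the step function
-- receives the counter, the previous value and the parameters, in that order.
data Eval (A : Oracle) : ∀ {n} → Code n → Vec ℕ n → ℕ → Set where
  zer   : ∀ {n} {xs : Vec ℕ n} → Eval A zer xs 0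
  succ  : ∀ {x} → Eval A succ (x ∷ []) (suc x)
  proj  : ∀ {n} {xs : Vec ℕ n} i → Eval A (proj i) xs (lookup xs i)
  orc   : ∀ {x} → Eval A orc (x ∷ []) (χ A x)
  comp  : ∀ {m n} {p : Code m} {qs : Vec (Code n) m} {xs ys z} →
          Pointwise (λ q y → Eval A q xs y) qs ys →
          Eval A p ys z → Eval A (comp p qs) xs z
  prec₀ : ∀ {n} {p : Code n} {q xs y} →
          Eval A p xs y → Eval A (prec p q) (0 ∷ xs) y
  precₛ : ∀ {n} {p : Code n} {q k xs y z} →
          Eval A (prec p q) (k ∷ xs) y → Eval A q (k ∷ y ∷ xs) z →
          Eval A (prec p q) (suc k ∷ xs) z
  -- y is the least zero, and p halts at all smaller arguments.
  mu    : ∀ {n} {p : Code (suc n)} {xs y} →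
          Eval A p (y ∷ xs) 0 →
          (∀ {i} → i < y → ∃ λ k → Eval A p (i ∷ xs) (suc k)) →
          Eval A (mu p) xs y

_Computes_ : Oracle → (ℕ → ℕ) → Set
A Computes f = Σ (Code 1) λ p → ∀ x → Eval A p (x ∷ []) (f x)

infix 4 _≤T_ _≡T_

_≤T_ : Rel Oracle 0ℓ
B ≤T A = A Computes χ B

_≡T_ : Rel Oracle 0ℓ
A ≡T B = A ≤T B × B ≤T A

≤T-refl : ∀ {A} → A ≤T A
≤T-refl = orc , λ _ → orc

-- Replacing calls to the oracle by runs of c.
mutual
  substitute : Code 1 → Code n → Code n
  substitute c zer         = zer
  substitute c succ        = succ
  substitute c (proj i)    = proj i
  substitute c orc         = c
  substitute c (comp p qs) = comp (substitute c p) (substitutes c qs)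
  substitute c (prec p q)  = prec (substitute c p) (substitute c q)
  substitute c (mu p)      = mu (substitute c p)

  substitutes : Code 1 → Vec (Code n) m → Vec (Code n) m
  substitutes c []       = []
  substitutes c (q ∷ qs) = substitute c q ∷ substitutes c qs

module _ {A B : Oracle} (B≤A : B ≤T A) where mutual

  substitute-sound : ∀ {p : Code n} {xs y} → Eval B p xs y →
                     Eval A (substitute (proj₁ B≤A) p) xs y
  substitute-sound zer         = zer
  substitute-sound succ        = succ
  substitute-sound (proj i)    = proj i
  substitute-sound orc         = proj₂ B≤A _
  substitute-sound (comp es e) =
    comp (substitutes-sound es) (substitute-sound e)
  substitute-sound (prec₀ e)   = prec₀ (substitute-sound e)
  substitute-sound (precₛ d e) = precₛ (substitute-sound d) (substitute-sound e)
  substitute-sound (mu e h)    =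
    mu (substitute-sound e)
       λ i<y → proj₁ (h i<y) , substitute-sound (proj₂ (h i<y))

  substitutes-sound : ∀ {qs : Vec (Code n) m} {xs ys} →
    Pointwise (λ q y → Eval B q xs y) qs ys →
    Pointwise (λ q y → Eval A q xs y) (substitutes (proj₁ B≤A) qs) ys
  substitutes-sound []       = []
  substitutes-sound (e ∷ es) = substitute-sound e ∷ substitutes-sound es

Computes-mono : ∀ {A B f} → B ≤T A → B Computes f → A Computes f
Computes-mono B≤A (p , h) =
  substitute (proj₁ B≤A) p , λ x → substitute-sound B≤A (h x)

≤T-trans : ∀ {A B C} → A ≤T B → B ≤T C → A ≤T C
≤T-trans A≤B B≤C = Computes-mono B≤C A≤B

-- A Turing degree is a ≡T-class of oracles.  There being no quotient type, a
-- degree is given by any of its members, and a collection of degrees is a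
-- ≡T-invariant collection of oracles.
record Degrees ℓ : Set (Level.suc ℓ) where
  field
    members  : Pred Oracle ℓ
    respects : members Respects _≡T_

open Degrees public

UpwardClosed : Degrees ℓ → Set ℓ
UpwardClosed 𝒜 = ∀ {a d} → a ∈ members 𝒜 → a ≤T d → d ∈ members 𝒜

record IsBasis (ℬ : Degrees ℓ) (𝒜 : Degrees ℓ′) : Set (ℓ Level.⊔ ℓ′) where
  field
    incomparable : ∀ {a b} → a ∈ members ℬ → b ∈ members ℬ →
                   ¬ (a ≡T b) → ¬ (a ≤T b) × ¬ (b ≤T a)
    generates    : members 𝒜 ≐ λ d → ∃ λ b → b ∈ members ℬ × b ≤T d

-- Bijections onto the degrees in ℬ, so members are compared up to ≡T.
EnumeratedBy : Set → Degrees ℓ → Set ℓ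
EnumeratedBy I ℬ =
  Σ (I → ∃ (members ℬ)) (Bijective _≡_ (_≡T_ on proj₁))

Countable : Degrees ℓ → Set ℓ
Countable ℬ = (∃ λ n → EnumeratedBy (Fin n) ℬ) ⊎ EnumeratedBy ℕ ℬ

_≤[_]_ : Rel ℕ 0ℓ → Oracle → Rel ℕ 0ℓ → Set
R ≤[ d ] S = ∃ λ f → d Computes f × (∀ x y → R x y ⇔ S (f x) (f y))

_≡[_]_ : Rel ℕ 0ℓ → Oracle → Rel ℕ 0ℓ → Set
R ≡[ d ] S = R ≤[ d ] S × S ≤[ d ] R

DgSp⇔ : Rel ℕ 0ℓ → Rel ℕ 0ℓ → Degrees 0ℓ
DgSp⇔ R S = record
  { members  = λ d → R ≡[ d ] S
  ; respects = λ { (d≤e , _) (R≤S , S≤R) → mono R S d≤e R≤S , mono S R d≤e S≤R }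
  }
  where
  mono : ∀ R S {d e} → d ≤T e → R ≤[ d ] S → R ≤[ e ] S
  mono _ _ d≤e (f , d-f , red) = f , Computes-mono d≤e d-f , red

HasInfiniteClass : Rel ℕ 0ℓ → Set
HasInfiniteClass R = ∃ λ x → Inf (R x)

{-# OPTIONS --safe #-}

-- Let B₀, B₁, … represent the basis; after finite changes, Bᵢ agrees with B₀ below i.
-- Each class of R with more than one element is a star: a centre at level n, joined to
-- the code of Bᵢ ↾ n for each i < n.  All wrong guesses for such a code are singletons
-- of R.  In S there are copies of the stars for each i, with one spoke missing, namely
-- that of Bᵢ.  Knowing Bᵢ, one reduces R to S by moving the missing spoke to the centre;
-- S reduces to R computably.
--
-- Conversely let f reduce R to S.  If f identifies two points of a star at infinitely
-- many levels, then f enumerates codes of arbitrarily long initial segments.  If not,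
-- f is injective on all stars from some level on, and by pigeonhole it maps a star to a
-- star of higher level, as the stars of S are smaller; iterating f again enumerates
-- codes of arbitrarily long initial segments.  Either some i occurs infinitely often
-- among these, and they determine Bᵢ, or i tends to infinity, and they determine B₀
-- because Bᵢ agrees with B₀ below i.

module Submission where

open import Defs
open import Axiom.ExcludedMiddle using (ExcludedMiddle)
open import Data.Bool.Base using (if_then_else_; false)
open import Data.Fin.Base using (Fin; zero; suc; toℕ; fromℕ<; punchOut)
open import Data.Fin.Patterns using (0F; 1F; 3F)
open import Data.Fin.Properties
  using (toℕ-injective; toℕ<n; toℕ-fromℕ<; fromℕ<-injective; punchOut-injective; injective⇒≤)
open import Data.Nat.Base
open import Data.Nat.Properties
open import Data.Product using (∃; ∃₂; _×_; _,_; proj₁; proj₂)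
open import Data.Sum.Base using (_⊎_; inj₁; inj₂; [_,_]′)
open import Data.Vec.Base using (Vec; []; _∷_; lookup; tabulate)
open import Data.Vec.Relation.Binary.Pointwise.Inductive using (Pointwise; []; _∷_)
open import Function.Base using (_∘_; id; _on_)
open import Function.Bundles using (_⇔_; mk⇔; module Equivalence)
open import Level using (0ℓ)
import Relation.Binary.Construct.On as On
open import Relation.Binary.Core using (Rel)
open import Relation.Binary.PropositionalEquality
open import Relation.Binary.Structures using (IsEquivalence)
open import Relation.Nullary.Decidable
  using (Dec; yes; no; does; _×-dec_; dec-true; dec-false)
open import Relation.Nullary.Negation using (contradiction)
open import Relation.Nullary.Negation.Core using (¬_)
open import Relation.Unary using (Satisfiable; _≐_; _∈_)

private
  variable
    m n : ℕ
    A D E : Oracle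

-- Combinators for relativised recursive functions.

record Recursive (A : Oracle) (F : Vec ℕ n → ℕ) : Set where
  constructor _by_
  field
    program : Code n
    correct : ∀ xs → Eval A program xs (F xs)

open Recursive

private
  variable
    F G H : Vec ℕ n → ℕ

var : ∀ i → Recursive {n} A (λ xs → lookup xs i)
var i = proj i by λ _ → proj i

computes : ∀ {f} → Recursive {1} A (λ xs → f (lookup xs 0F)) → A Computes f
computes e = program e , λ x → correct e (x ∷ [])

appʳ : ∀ {f} → A Computes f → Recursive A F → Recursive A (λ xs → f (F xs))
appʳ (p , c) e =
  comp p (program e ∷ []) by λ xs → comp (correct e xs ∷ []) (c _)

convʳ : (∀ xs → F xs ≡ G xs) → Recursive A F → Recursive A G
convʳ F≗G e = program e by λ xs → subst (Eval _ _ xs) (F≗G xs) (correct e xs)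

sucʳ : Recursive A F → Recursive A (λ xs → suc (F xs))
sucʳ = appʳ (succ , λ _ → succ)

litʳ : ∀ k → Recursive {n} A (λ _ → k)
litʳ zero    = zer by λ _ → zer
litʳ (suc k) = sucʳ (litʳ k)

natrec : ℕ → (ℕ → ℕ → ℕ) → ℕ → ℕ
natrec z s zero    = z
natrec z s (suc k) = s k (natrec z s k)

-- Only the identity is wanted as `f`, to hand all parameters on to `prec`; the induction needs a
-- general `f`, as passing to the tail composes it with `suc`.
projections-correct : ∀ {xs : Vec ℕ n} (ys : Vec ℕ m) (f : Fin m → Fin n) →
  (∀ i → lookup xs (f i) ≡ lookup ys i) →
  Pointwise (λ q y → Eval A q xs y) (tabulate (proj ∘ f)) ys
projections-correct []       f eq = []
projections-correct (y ∷ ys) f eq =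
  subst (Eval _ _ _) (eq 0F) (proj (f 0F)) ∷
  projections-correct ys (f ∘ suc) (eq ∘ suc)

natrecʳ : Recursive {n} A F → Recursive A G → Recursive A H →
  Recursive A (λ xs → natrec (F xs) (λ k y → G (k ∷ y ∷ xs)) (H xs))
natrecʳ {A = A} {F = F} {G = G} e d c =
  comp (prec (program e) (program d)) (program c ∷ tabulate proj)
    by λ xs → comp (correct c xs ∷ projections-correct xs id λ _ → refl) (go xs _)
  where
  go : ∀ xs k → Eval A (prec (program e) (program d)) (k ∷ xs)
                  (natrec (F xs) (λ k y → G (k ∷ y ∷ xs)) k)
  go xs zero    = prec₀ (correct e xs)
  go xs (suc k) = precₛ (go xs k) (correct d _)

IsLeastZero : (ℕ → ℕ) → ℕ → Set
IsLeastZero f y = f y ≡ 0 × (∀ {i} → i < y → ∃ λ k → f i ≡ suc k)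

least : ∀ (f : ℕ → ℕ) → (∃ λ y → f y ≡ 0) → ∃ (IsLeastZero f)
least f (zero  , fy≡0) = zero , fy≡0 , λ ()
least f (suc y , fy≡0) with f 0 in eq | least (f ∘ suc) (y , fy≡0)
... | zero  | _            = zero , eq , λ ()
... | suc k | z , fz≡0 , below = suc z , fz≡0 , below′
  where
  below′ : ∀ {i} → i < suc z → ∃ λ k → f i ≡ suc k
  below′ {zero}  _         = k , eq
  below′ {suc i} (s≤s i<z) = below i<z

-- The existence proof `z` shows that the search halts but does not enter the program, so it may
-- come from excluded middle.
searchʳ : Recursive {suc n} A F → (z : ∀ xs → ∃ λ y → F (y ∷ xs) ≡ 0) →
  Recursive A (λ xs → proj₁ (least (λ y → F (y ∷ xs)) (z xs)))
searchʳ {A = A} {F = F} e z = mu (program e) by λ xs →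
  let (y , Fy≡0 , min) = least (λ y → F (y ∷ xs)) (z xs) in
  mu (subst (Eval A _ _) Fy≡0 (correct e _))
     (λ i<y → proj₁ (min i<y) , subst (Eval A _ _) (proj₂ (min i<y)) (correct e _))

infixl 6 _+ʳ_ _∸ʳ_ _⊓ʳ_

_+ʳ_ : Recursive A F → Recursive A G → Recursive A (λ xs → F xs + G xs)
_+ʳ_ {F = F} e d = convʳ (λ xs → eq (F xs)) (natrecʳ d (sucʳ (var 1F)) e)
  where
  eq : ∀ m {n} → natrec n (λ _ → suc) m ≡ m + n
  eq zero    = refl
  eq (suc m) = cong suc (eq m)

predʳ : Recursive A F → Recursive A (λ xs → pred (F xs))
predʳ {F = F} e = convʳ (λ xs → eq (F xs)) (natrecʳ (litʳ 0) (var 0F) e)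
  where
  eq : ∀ m → natrec 0 (λ k _ → k) m ≡ pred m
  eq zero    = refl
  eq (suc m) = refl

_∸ʳ_ : Recursive A F → Recursive A G → Recursive A (λ xs → F xs ∸ G xs)
_∸ʳ_ {F = F} {G = G} e d =
  convʳ (λ xs → eq (F xs) (G xs)) (natrecʳ e (predʳ (var 1F)) d)
  where
  eq : ∀ m n → natrec m (λ _ → pred) n ≡ m ∸ n
  eq m zero    = refl
  eq m (suc n) = trans (cong pred (eq m n)) (pred[m∸n]≡m∸[1+n] m n)

∣_-_∣ʳ : Recursive A F → Recursive A G → Recursive A (λ xs → ∣ F xs - G xs ∣)
∣_-_∣ʳ {F = F} {G = G} e d =
  convʳ (λ xs → eq (F xs) (G xs)) ((e ∸ʳ d) +ʳ (d ∸ʳ e))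
  where
  eq : ∀ m n → (m ∸ n) + (n ∸ m) ≡ ∣ m - n ∣
  eq zero    zero    = refl
  eq zero    (suc n) = refl
  eq (suc m) zero    = +-identityʳ (suc m)
  eq (suc m) (suc n) = eq m n

_⊓ʳ_ : Recursive A F → Recursive A G → Recursive A (λ xs → F xs ⊓ G xs)
_⊓ʳ_ {F = F} {G = G} e d =
  convʳ (λ xs → eq (F xs) (G xs)) (e ∸ʳ (e ∸ʳ d))
  where
  eq : ∀ m n → m ∸ (m ∸ n) ≡ m ⊓ n
  eq zero    n       = 0∸n≡0 (0 ∸ n)
  eq (suc m) zero    = n∸n≡0 m
  eq (suc m) (suc n) = trans (+-∸-assoc 1 (m∸n≤m m n)) (cong suc (eq m n))

-- Tests are numbers, with 0 for true; so _+_ is conjunction and ∣ x - y ∣ tests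
-- for equality.
ifz : ℕ → ℕ → ℕ → ℕ
ifz zero    x y = x
ifz (suc _) x y = y

ifzʳ : Recursive A F → Recursive A G → Recursive A H →
  Recursive A (λ xs → ifz (F xs) (G xs) (H xs))
ifzʳ {A = A} {F = F} {G = G} {H = H} e d c =
  comp {m = 3} chosen (program e ∷ program d ∷ program c ∷ [])
    by λ xs → comp (correct e xs ∷ correct d xs ∷ correct c xs ∷ [])
                   (run (F xs) (G xs) (H xs))
  where
  chosen : Code 3
  -- The step function sees the counter, the previous value, `x` and `y`, so `proj 3F` is `y`.
  chosen = prec (proj 0F) (proj 3F)
  run : ∀ l x y → Eval A chosen (l ∷ x ∷ y ∷ []) (ifz l x y)
  run zero    x y = prec₀ (proj 0F)
  run (suc l) x y = precₛ (run l x y) (proj 3F)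

-- Cantor pairing.

tri : ℕ → ℕ
tri zero    = zero
tri (suc n) = suc (n + tri n)

triʳ : Recursive A F → Recursive A (λ xs → tri (F xs))
triʳ {F = F} e =
  convʳ (λ xs → eq (F xs)) (natrecʳ (litʳ 0) (sucʳ (var 0F +ʳ var 1F)) e)
  where
  eq : ∀ n → natrec 0 (λ k y → suc (k + y)) n ≡ tri n
  eq zero    = refl
  eq (suc n) = cong (λ y → suc (n + y)) (eq n)

-- The largest r with `tri r` at most the argument: it rises by one exactly when the next triangular
-- number is reached, so primitive recursion suffices.
root : ℕ → ℕ
root zero    = zero
root (suc z) = ifz ∣ suc z - tri (suc (root z)) ∣ (suc (root z)) (root z)

rootʳ : Recursive A F → Recursive A (λ xs → root (F xs))
rootʳ {F = F} e = convʳ (λ xs → eq (F xs)) (natrecʳ (litʳ 0)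
    (ifzʳ ∣ sucʳ (var 0F) - triʳ (sucʳ (var 1F)) ∣ʳ (sucʳ (var 1F)) (var 1F)) e)
  where
  step : ℕ → ℕ → ℕ
  step z r = ifz ∣ suc z - tri (suc r) ∣ (suc r) r
  eq : ∀ z → natrec 0 step z ≡ root z
  eq zero    = refl
  eq (suc z) = cong (step z) (eq z)

-- Induction along the r-th diagonal, entered from the last entry of the one before; the root could
-- rise at `suc a` only if `a` were already `r`.
root-tri : ∀ r a → a ≤ r → root (tri r + a) ≡ r
root-tri zero    zero    _   = refl
root-tri (suc r) zero    _
  rewrite +-identityʳ (r + tri r) | +-comm r (tri r) | root-tri r r ≤-refl
        | +-comm r (tri r) | ∣n-n∣≡0 (tri r + r) = refl
root-tri r       (suc a) a<r
  rewrite +-suc (tri r) a | root-tri r a (<⇒≤ a<r)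
  with ∣ tri r + a - r + tri r ∣ in eq
... | suc _ = refl
... | zero  = contradiction
  (+-cancelˡ-≡ (tri r) a r (trans (∣m-n∣≡0⇒m≡n eq) (+-comm r (tri r)))) (<⇒≢ a<r)

opaque
  ⟨_,_⟩ : ℕ → ℕ → ℕ
  ⟨ a , b ⟩ = tri (a + b) + a

  fst snd : ℕ → ℕ
  fst z = z ∸ tri (root z)
  snd z = root z ∸ fst z

  ⟨_,_⟩ʳ : Recursive A F → Recursive A G → Recursive A (λ xs → ⟨ F xs , G xs ⟩)
  ⟨ e , d ⟩ʳ = triʳ (e +ʳ d) +ʳ e

  fstʳ : Recursive A F → Recursive A (λ xs → fst (F xs))
  fstʳ e = e ∸ʳ triʳ (rootʳ e)

  sndʳ : Recursive A F → Recursive A (λ xs → snd (F xs))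
  sndʳ e = rootʳ e ∸ʳ fstʳ e

  root-pair : ∀ a b → root ⟨ a , b ⟩ ≡ a + b
  root-pair a b = root-tri (a + b) a (m≤m+n a b)

  fst-pair : ∀ a b → fst ⟨ a , b ⟩ ≡ a
  fst-pair a b rewrite root-pair a b = m+n∸m≡n (tri (a + b)) a

  snd-pair : ∀ a b → snd ⟨ a , b ⟩ ≡ b
  snd-pair a b rewrite fst-pair a b | root-pair a b = m+n∸m≡n a b

  -- Counts through the diagonals: `⟨ a , suc b ⟩` is followed by `⟨ suc a , b ⟩`, and the end
  -- `⟨ a , 0 ⟩` of a diagonal by the start `⟨ 0 , suc a ⟩` of the next.
  pair-surjective : ∀ z → ∃₂ λ a b → z ≡ ⟨ a , b ⟩
  pair-surjective zero    = 0 , 0 , refl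
  pair-surjective (suc z) with pair-surjective z
  ... | a , suc b , refl = suc a , b , (begin
    suc (tri (a + suc b) + a)  ≡⟨ +-suc _ a ⟨
    tri (a + suc b) + suc a    ≡⟨ cong (λ w → tri w + suc a) (+-suc a b) ⟩
    tri (suc a + b) + suc a    ∎)
    where open ≡-Reasoning
  ... | a , zero , refl = 0 , suc a , (begin
    suc (tri (a + 0) + a)      ≡⟨ cong (λ w → suc (tri w + a)) (+-identityʳ a) ⟩
    suc (tri a + a)            ≡⟨ cong suc (+-comm (tri a) a) ⟩
    tri (suc a)                ≡⟨ +-identityʳ _ ⟨
    tri (suc a) + 0            ∎)
    where open ≡-Reasoning

  pair-fst-snd : ∀ z → ⟨ fst z , snd z ⟩ ≡ z
  pair-fst-snd z with pair-surjective z
  ... | a , b , refl = cong₂ ⟨_,_⟩ (fst-pair a b) (snd-pair a b)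

pair-injective : ∀ {a b c d} → ⟨ a , b ⟩ ≡ ⟨ c , d ⟩ → a ≡ c × b ≡ d
pair-injective {a} {b} {c} {d} eq =
  trans (sym (fst-pair a b)) (trans (cong fst eq) (fst-pair c d)) ,
  trans (sym (snd-pair a b)) (trans (cong snd eq) (snd-pair c d))

fst-snd-injective : ∀ {y z} → fst y ≡ fst z → snd y ≡ snd z → y ≡ z
fst-snd-injective {y} {z} p q =
  trans (sym (pair-fst-snd y)) (trans (cong₂ ⟨_,_⟩ p q) (pair-fst-snd z))

-- Codes of initial segments, and finite changes of a function.

code : Oracle → ℕ → ℕ
code D zero    = zero
code D (suc n) = ⟨ χ D n , code D n ⟩

codeʳ : A Computes χ D → Recursive A F → Recursive A (λ xs → code D (F xs))
codeʳ {D = D} {F = F} c e =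
  convʳ (λ xs → eq (F xs)) (natrecʳ (litʳ 0) ⟨ appʳ c (var 0F) , var 1F ⟩ʳ e)
  where
  eq : ∀ n → natrec 0 (λ k y → ⟨ χ D k , y ⟩) n ≡ code D n
  eq zero    = refl
  eq (suc n) = cong ⟨ χ D n ,_⟩ (eq n)

code-cong : (∀ x → x < n → D x ≡ E x) → code D n ≡ code E n
code-cong {zero}  D≗E = refl
code-cong {suc n} {D} {E} D≗E = cong₂ ⟨_,_⟩
  (cong (if_then 1 else 0) (D≗E n ≤-refl))
  (code-cong {n} {D} {E} λ x x<n → D≗E x (m<n⇒m<1+n x<n))

-- The last bit of a segment is outermost in its code, so the bits after position x have to be
-- stripped off first; a code does not record its own length `n`.
bit : ℕ → ℕ → ℕ → ℕ
bit n s x = fst (natrec s (λ _ → snd) (n ∸ suc x))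

bitʳ : Recursive A F → Recursive A G → Recursive A H →
  Recursive A (λ xs → bit (F xs) (G xs) (H xs))
bitʳ e d c = fstʳ (natrecʳ d (sndʳ (var 1F)) (e ∸ʳ sucʳ c))

bit-code : ∀ D {n x} → x < n → bit n (code D n) x ≡ χ D x
bit-code D {n} {x} x<n = begin
  bit n (code D n) x
    ≡⟨ cong (λ l → fst (natrec (code D l) (λ _ → snd) k)) (m∸n+n≡m x<n) ⟨
  fst (natrec (code D (k + suc x)) (λ _ → snd) k)
    ≡⟨ cong fst (tails k (suc x)) ⟩
  fst (code D (suc x))
    ≡⟨ fst-pair _ _ ⟩
  χ D x
    ∎
  where
  open ≡-Reasoning
  k = n ∸ suc x
  tails : ∀ k m → natrec (code D (k + m)) (λ _ → snd) k ≡ code D m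
  tails zero    m = refl
  tails (suc k) m = trans
    (cong snd (trans (cong (λ l → natrec (code D l) (λ _ → snd) k) (sym (+-suc k m)))
                     (tails k (suc m))))
    (snd-pair _ _)

-- The finitely many values below `k` are built into the program one at a time, from the top down.
Computes-ext : ∀ {f g} k → (∀ x → k ≤ x → f x ≡ g x) → A Computes f → A Computes g
Computes-ext zero f≗g (p , c) = p , λ x → subst (Eval _ p _) (f≗g x z≤n) (c x)
Computes-ext {A} {f} {g} (suc k) f≗g c = Computes-ext {f = f′} k f′≗g
  (computes (ifzʳ ∣ var 0F - litʳ k ∣ʳ (litʳ (g k)) (appʳ c (var 0F))))
  where
  f′ : ℕ → ℕ
  f′ x = ifz ∣ x - k ∣ (g k) (f x)
  f′≗g : ∀ x → k ≤ x → f′ x ≡ g x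
  f′≗g x k≤x with ∣ x - k ∣ in eq
  ... | zero  = cong g (sym (∣m-n∣≡0⇒m≡n eq))
  ... | suc _ = f≗g x (≤∧≢⇒< k≤x λ k≡x →
                  0≢1+n (trans (sym (m≡n⇒∣m-n∣≡0 (sym k≡x))) eq))

bound : ∀ (f : ℕ → ℕ) N → ∃ λ M → ∀ {i} → i ≤ N → f i < M
bound f zero    = suc (f 0) , λ { z≤n → ≤-refl }
bound f (suc N) with bound f N
... | M , f<M = suc (f (suc N)) ⊔ M , λ i≤1+N → case (m≤n⇒m<n∨m≡n i≤1+N)
  where
  case : ∀ {i} → i < suc N ⊎ i ≡ suc N → f i < suc (f (suc N)) ⊔ M
  case (inj₁ (s≤s i≤N)) = <-≤-trans (f<M i≤N) (m≤n⊔m _ M)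
  case (inj₂ refl)      = m≤m⊔n _ M

-- Guesses, and hiding a spoke.

-- A number z is read as a guess ⟨ n , ⟨ j , s ⟩ ⟩ that s codes the first n bits of the
-- j-th oracle; index 0 is the centre of the star at level n.  A point of R or S is a
-- pair ⟨ k , z ⟩: in R the copy k consists of singletons unless snd k ≡ 0, and in S the
-- number snd k is the index of the missing spoke.
level index prefix : ℕ → ℕ
level z  = fst z
index z  = fst (snd z)
prefix z = snd (snd z)

levelʳ : Recursive A F → Recursive A (λ xs → level (F xs))
levelʳ = fstʳ

indexʳ : Recursive A F → Recursive A (λ xs → index (F xs))
indexʳ e = fstʳ (sndʳ e)

prefixʳ : Recursive A F → Recursive A (λ xs → prefix (F xs))
prefixʳ e = sndʳ (sndʳ e)

-- Nonzero if z is missing from the stars of the copies ⟨ k , i ⟩ of S.  The minimum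
-- ensures that a spoke is missing also from the stars with no spoke of index i.
flag : ℕ → ℕ → ℕ
flag i z = ifz i 1 (ifz ∣ index z - i ⊓ level z ∣ 1 0)

flagʳ : Recursive A F → Recursive A G → Recursive A (λ xs → flag (F xs) (G xs))
flagʳ e d =
  ifzʳ e (litʳ 1) (ifzʳ ∣ indexʳ d - e ⊓ʳ levelʳ d ∣ʳ (litʳ 1) (litʳ 0))

-- This will embed `S` in `R`: a point with nonzero flag is sent into a copy that consists of
-- singletons.
hide : ℕ → ℕ
hide x = ⟨ ⟨ fst x , flag (snd (fst x)) (snd x) ⟩ , snd x ⟩

hideʳ : Recursive A F → Recursive A (λ xs → hide (F xs))
hideʳ e = ⟨ ⟨ fstʳ e , flagʳ (sndʳ (fstʳ e)) (sndʳ e) ⟩ʳ , sndʳ e ⟩ʳ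

unhide : ℕ → ℕ
unhide x = ⟨ fst (fst x) , snd x ⟩

unhide-hide : ∀ x → unhide (hide x) ≡ x
unhide-hide x = fst-snd-injective
  (trans (fst-pair _ _) (trans (cong fst (fst-pair _ _)) (fst-pair _ _)))
  (trans (snd-pair _ _) (snd-pair _ _))

hide-injective : ∀ {x y} → hide x ≡ hide y → x ≡ y
hide-injective eq =
  trans (sym (unhide-hide _)) (trans (cong unhide eq) (unhide-hide _))

ifz-zero : ∀ {c x y} → c ≡ 0 → ifz c x y ≡ x
ifz-zero refl = refl

ifz-nonzero : ∀ {c x y} → c ≢ 0 → ifz c x y ≡ y
ifz-nonzero {zero}  c≢0 = contradiction refl c≢0
ifz-nonzero {suc _} c≢0 = refl

-- The relations and the finiteness of their classes.

module Construction
  (C : ℕ → Oracle) (L : Oracle)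
  (C→L : ∀ {i x} → x < i → C i x ≡ L x)
  (C₀-computable : ∀ {A} → A Computes χ (C 0))
  where

  spoke : ℕ → ℕ → ℕ
  spoke j n = ⟨ n , ⟨ j , code (C j) n ⟩ ⟩

  -- Taking the centre as the spoke of the computable oracle `C 0` makes all centres computable; the
  -- oracles of interest are `C 1`, `C 2` and so on, which converge to `L`.
  centre : ℕ → ℕ
  centre = spoke 0

  centreʳ : Recursive A F → Recursive A (λ xs → centre (F xs))
  centreʳ e = ⟨ e , ⟨ litʳ 0 , codeʳ C₀-computable e ⟩ʳ ⟩ʳ

  Genuine : ℕ → Set
  Genuine z = index z ≤ level z × prefix z ≡ code (C (index z)) (level z)

  genuine? : ∀ z → Dec (Genuine z)
  genuine? z = (index z ≤? level z) ×-dec (prefix z ≟ _)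

  level-spoke : ∀ j n → level (spoke j n) ≡ n
  level-spoke j n = fst-pair _ _

  index-spoke : ∀ j n → index (spoke j n) ≡ j
  index-spoke j n = trans (cong fst (snd-pair _ _)) (fst-pair _ _)

  prefix-spoke : ∀ j n → prefix (spoke j n) ≡ code (C j) n
  prefix-spoke j n = trans (cong snd (snd-pair _ _)) (snd-pair _ _)

  spoke-genuine : ∀ {j n} → j ≤ n → Genuine (spoke j n)
  spoke-genuine {j} {n} j≤n
    rewrite level-spoke j n | index-spoke j n = j≤n , prefix-spoke j n

  genuine-spoke : ∀ {z} → Genuine z → z ≡ spoke (index z) (level z)
  genuine-spoke {z} (_ , eq) = trans (sym (pair-fst-snd z))
    (cong ⟨ fst z ,_⟩ (trans (sym (pair-fst-snd (snd z))) (cong ⟨ index z ,_⟩ eq)))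

  Live : ℕ → Set
  Live x = snd (fst x) ≡ 0 × Genuine (snd x)

  live? : ∀ x → Dec (Live x)
  live? x = (snd (fst x) ≟ 0) ×-dec genuine? (snd x)

  opaque
    -- Chooses a representative of each class, so that `R` can be defined as a kernel. It enters no
    -- program and need not be computable.
    contract : ℕ → ℕ
    contract x with live? x
    ... | yes _ = ⟨ fst x , centre (level (snd x)) ⟩
    ... | no  _ = x

    contract-live : ∀ {x} → Live x → contract x ≡ ⟨ fst x , centre (level (snd x)) ⟩
    contract-live {x} l with live? x
    ... | yes _ = refl
    ... | no ¬l = contradiction l ¬l

    contract-dead : ∀ {x} → ¬ Live x → contract x ≡ x
    contract-dead {x} ¬l with live? x
    ... | yes l = contradiction l ¬l
    ... | no  _ = refl

    fst-contract : ∀ x → fst (contract x) ≡ fst x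
    fst-contract x with live? x
    ... | yes _ = fst-pair _ _
    ... | no  _ = refl

    contract-centre : ∀ a n → contract ⟨ a , centre n ⟩ ≡ ⟨ a , centre n ⟩
    contract-centre a n with live? ⟨ a , centre n ⟩
    ... | no _  = refl
    ... | yes _ = cong₂ ⟨_,_⟩ (fst-pair _ _)
      (cong centre (trans (cong level (snd-pair _ _)) (level-spoke 0 n)))

  R S : Rel ℕ 0ℓ
  R = _≡_ on contract
  S = R on hide

  R-isEquivalence : IsEquivalence R
  R-isEquivalence = On.isEquivalence contract isEquivalence

  S-isEquivalence : IsEquivalence S
  S-isEquivalence = On.isEquivalence hide R-isEquivalence

  centre-live : ∀ {x} n → snd (fst x) ≡ 0 → Live ⟨ fst x , centre n ⟩
  centre-live {x} n eq = trans (cong snd (fst-pair _ _)) eq ,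
    subst Genuine (sym (snd-pair _ _)) (spoke-genuine z≤n)

  Siblings : ℕ → ℕ → Set
  Siblings x y = Live x × Live y × fst x ≡ fst y × level (snd x) ≡ level (snd y)

  -- A live point contracts to a centre, which is live again, while a dead point stays where it is;
  -- so a dead point is related to itself only.
  R⇒siblings : ∀ {x y} → R x y → x ≢ y → Siblings x y
  R⇒siblings {x} {y} eq x≢y with live? x | live? y
  ... | no ¬l | no ¬l′ = contradiction
    (trans (sym (contract-dead ¬l)) (trans eq (contract-dead ¬l′))) x≢y
  ... | yes l | no ¬l′ = contradiction
    (subst Live (trans (sym (contract-live l)) (trans eq (contract-dead ¬l′)))
      (centre-live {x} _ (proj₁ l))) ¬l′
  ... | no ¬l | yes l′ = contradiction
    (subst Live (trans (sym (contract-live l′)) (trans (sym eq) (contract-dead ¬l)))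
      (centre-live {y} _ (proj₁ l′))) ¬l
  ... | yes l | yes l′
    with pair-injective (trans (sym (contract-live l)) (trans eq (contract-live l′)))
  ... | fst≡ , centre≡ = l , l′ , fst≡ , proj₁ (pair-injective centre≡)

  siblings⇒R : ∀ {x y} → Siblings x y → R x y
  siblings⇒R (l , l′ , fst≡ , level≡) = trans (contract-live l)
    (trans (cong₂ ⟨_,_⟩ fst≡ (cong centre level≡)) (sym (contract-live l′)))

  -- Apart from `x` itself, the class can only contain spokes in the same copy and at the same
  -- level, whose indices are at most that level.
  R-class-bounded : ∀ x → ∃ λ M → ∀ {y} → R x y → y < M
  R-class-bounded x = suc x ⊔ M , go
    where
    M,spokes<M = bound (λ j → ⟨ fst x , spoke j (level (snd x)) ⟩) (level (snd x))
    M = proj₁ M,spokes<M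
    go : ∀ {y} → R x y → y < suc x ⊔ M
    go {y} xRy with x ≟ y
    ... | yes refl = m≤m⊔n (suc x) M
    ... | no x≢y with R⇒siblings {x} {y} xRy x≢y
    ... | _ , (_ , g) , fst≡ , level≡ =
      subst (_< _)
        (trans (cong₂ (λ a n → ⟨ a , spoke (index (snd y)) n ⟩) fst≡ level≡)
          (trans (cong ⟨ fst y ,_⟩ (sym (genuine-spoke g))) (pair-fst-snd y)))
        (<-≤-trans (proj₂ M,spokes<M (subst (index (snd y) ≤_) (sym level≡) (proj₁ g)))
          (m≤n⊔m (suc x) M))

  S-class-bounded : ∀ x → ∃ λ M → ∀ {y} → S x y → y < M
  S-class-bounded x with R-class-bounded (hide x)
  ... | N , hide<N with bound unhide N
  ... | M , unhide<M = M , λ {y} xSy →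
    subst (_< M) (unhide-hide y) (unhide<M (<⇒≤ (hide<N xSy)))

  -- Reducing `R` to `S` with one of the oracles.

  code-⊓ : ∀ i n → code (C (i ⊓ n)) n ≡ code (C i) n
  code-⊓ i n with ≤-total i n
  ... | inj₁ i≤n rewrite m≤n⇒m⊓n≡m i≤n = refl
  -- Cutting the index down to `n` is harmless: `C n` and `C i` both agree with `L` below `n`.
  ... | inj₂ n≤i rewrite m≥n⇒m⊓n≡n n≤i = code-cong λ x x<n →
    trans (C→L x<n) (sym (C→L (<-≤-trans x<n n≤i)))

  -- C i computes this predicate of z, although being genuine refers to the other
  -- oracles: below i all of them agree with L.
  Recognised : ℕ → ℕ → Set
  Recognised i z = index z ≡ i ⊓ level z × prefix z ≡ code (C i) (level z)

  recognised⇒genuine : ∀ {i z} → Recognised i z → Genuine z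
  recognised⇒genuine {i} {z} (p , q) =
    subst (_≤ level z) (sym p) (m⊓n≤n i (level z)) ,
    trans q (sym (trans (cong (λ j → code (C j) (level z)) p) (code-⊓ i (level z))))

  genuine⇒recognised : ∀ {i z} → Genuine z → index z ≡ i ⊓ level z → Recognised i z
  genuine⇒recognised {i} {z} (_ , q) p =
    p , trans q (trans (cong (λ j → code (C j) (level z)) p) (code-⊓ i (level z)))

  -- Only the spoke of index i ⊓ level z is missing in the copies ⟨ k , i ⟩ of S, so
  -- moving it to the centre turns a star of R into a star of S.
  gather : ℕ → ℕ → ℕ
  gather i z =
    ifz (∣ index z - i ⊓ level z ∣ + ∣ prefix z - code (C i) (level z) ∣)
        (centre (level z)) z

  gather-recognised : ∀ {i z} → Recognised i z → gather i z ≡ centre (level z)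
  gather-recognised (p , q) =
    ifz-zero (cong₂ _+_ (m≡n⇒∣m-n∣≡0 p) (m≡n⇒∣m-n∣≡0 q))

  gather-other : ∀ {i z} → ¬ Recognised i z → gather i z ≡ z
  gather-other {i} {z} ¬pq = ifz-nonzero λ eq → ¬pq
    ( ∣m-n∣≡0⇒m≡n (m+n≡0⇒m≡0 _ eq)
    , ∣m-n∣≡0⇒m≡n (m+n≡0⇒n≡0 ∣ index z - i ⊓ level z ∣ eq))

  -- A copy of the stars goes to one with missing index `i`; a copy of singletons goes to one with
  -- index 0, where every flag is nonzero and so all points are singletons.
  place : ℕ → ℕ → ℕ → ℕ
  place i k z = ⟨ ⟨ k , ifz (snd k) i 0 ⟩ , z ⟩

  fold : ℕ → ℕ → ℕ
  fold i x = place i (fst x) (ifz (snd (fst x)) (gather i (snd x)) (snd x))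

  foldʳ : ∀ {i} → A Computes χ (C i) → Recursive A F →
          Recursive A (λ xs → fold i (F xs))
  foldʳ {i = i} c e =
    ⟨ ⟨ fstʳ e , ifzʳ b (litʳ i) (litʳ 0) ⟩ʳ
    , ifzʳ b (ifzʳ (∣ indexʳ z - litʳ i ⊓ʳ levelʳ z ∣ʳ +ʳ
                    ∣ prefixʳ z - codeʳ c (levelʳ z) ∣ʳ)
                   (centreʳ (levelʳ z)) z)
             z
    ⟩ʳ
    where
    b = sndʳ (fstʳ e)
    z = sndʳ e

  fst-hide : ∀ x → fst (hide x) ≡ ⟨ fst x , flag (snd (fst x)) (snd x) ⟩
  fst-hide x = fst-pair _ _

  snd-hide : ∀ x → snd (hide x) ≡ snd x
  snd-hide x = snd-pair _ _

  live-hide⇒flag : ∀ {x} → Live (hide x) → flag (snd (fst x)) (snd x) ≡ 0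
  live-hide⇒flag {x} (eq , _) =
    trans (sym (trans (cong snd (fst-hide x)) (snd-pair _ _))) eq

  live-hide⇒genuine : ∀ {x} → Live (hide x) → Genuine (snd x)
  live-hide⇒genuine {x} (_ , g) = subst Genuine (snd-hide x) g

  hide-pair : ∀ k i z → hide ⟨ ⟨ k , i ⟩ , z ⟩ ≡ ⟨ ⟨ ⟨ k , i ⟩ , flag i z ⟩ , z ⟩
  hide-pair k i z = cong₂ ⟨_,_⟩
    (cong₂ ⟨_,_⟩ (fst-pair _ _)
      (cong₂ flag (trans (cong snd (fst-pair _ _)) (snd-pair _ _)) (snd-pair _ _)))
    (snd-pair _ _)

  flag-zero : ∀ {i z} → index z ≢ suc i ⊓ level z → flag (suc i) z ≡ 0
  flag-zero {i} {z} ≢m with ∣ index z - suc i ⊓ level z ∣ in eq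
  ... | zero  = contradiction (∣m-n∣≡0⇒m≡n eq) ≢m
  ... | suc _ = refl

  flag-zero⁻¹ : ∀ i {z} → flag i z ≡ 0 → index z ≢ i ⊓ level z
  flag-zero⁻¹ (suc i) {z} eq ≡m with ∣ index z - suc i ⊓ level z ∣ in eq′
  flag-zero⁻¹ (suc i) {z} () ≡m | zero
  ... | suc _ = contradiction (trans (sym (m≡n⇒∣m-n∣≡0 ≡m)) eq′) 0≢1+n

  place-injective : ∀ {i k l y z} → place i k y ≡ place i l z → k ≡ l × y ≡ z
  place-injective eq with pair-injective eq
  ... | eq₁ , y≡z = proj₁ (pair-injective eq₁) , y≡z

  hidden : ℕ → ℕ → ℕ → ℕ
  hidden k i z = hide ⟨ ⟨ k , i ⟩ , z ⟩

  contract-hidden-dead : ∀ {k i z} → ¬ (flag i z ≡ 0 × Genuine z) →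
                         contract (hidden k i z) ≡ hidden k i z
  contract-hidden-dead ¬l = contract-dead λ l → ¬l
    ( subst (_≡ 0)
        (cong₂ flag (trans (cong snd (fst-pair _ _)) (snd-pair _ _)) (snd-pair _ _))
        (live-hide⇒flag l)
    , subst Genuine (snd-pair _ _) (live-hide⇒genuine l))

  contract-hidden-live : ∀ {k i z} → flag i z ≡ 0 → Genuine z →
    contract (hidden k i z) ≡ ⟨ ⟨ ⟨ k , i ⟩ , 0 ⟩ , centre (level z) ⟩
  contract-hidden-live {k} {i} {z} eq g = begin
    contract (hidden k i z)
      ≡⟨ cong contract (hide-pair k i z) ⟩
    contract ⟨ ⟨ ⟨ k , i ⟩ , flag i z ⟩ , z ⟩
      ≡⟨ cong (λ b → contract ⟨ ⟨ ⟨ k , i ⟩ , b ⟩ , z ⟩) eq ⟩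
    contract ⟨ ⟨ ⟨ k , i ⟩ , 0 ⟩ , z ⟩
      ≡⟨ contract-live live ⟩
    ⟨ fst ⟨ ⟨ ⟨ k , i ⟩ , 0 ⟩ , z ⟩ , centre (level (snd ⟨ ⟨ ⟨ k , i ⟩ , 0 ⟩ , z ⟩)) ⟩
      ≡⟨ cong₂ ⟨_,_⟩ (fst-pair _ _) (cong (centre ∘ level) (snd-pair _ _)) ⟩
    ⟨ ⟨ ⟨ k , i ⟩ , 0 ⟩ , centre (level z) ⟩
      ∎
    where
    open ≡-Reasoning
    live : Live ⟨ ⟨ ⟨ k , i ⟩ , 0 ⟩ , z ⟩
    live = trans (cong snd (fst-pair _ _)) (snd-pair _ _) ,
           subst Genuine (sym (snd-pair _ _)) g

  contract-hidden-centre : ∀ k i n →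
    contract (hidden k i (centre n)) ≡ hidden k i (centre n)
  contract-hidden-centre k i n =
    trans (cong contract (hide-pair k i (centre n)))
      (trans (contract-centre _ n) (sym (hide-pair k i (centre n))))

  -- The centre could be the missing point only at level 0, where every genuine index is 0 and so
  -- `z` would be missing too.
  flag-centre : ∀ {i z} → Genuine z → index z ≢ suc i ⊓ level z →
                flag (suc i) (centre (level z)) ≡ 0
  flag-centre {i} {z} (index≤ , _) ≢m = flag-zero λ eq → go (level z) index≤ ≢m
    (trans (sym (index-spoke 0 _)) (trans eq (cong (suc i ⊓_) (level-spoke 0 _))))
    where
    go : ∀ n → index z ≤ n → index z ≢ suc i ⊓ n → 0 ≢ suc i ⊓ n
    go zero    index≤0 ≢0 _  = ≢0 (n≤0⇒n≡0 index≤0)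
    go (suc n) _       _  ()

  -- Here `w` is the guess in the `R`-representative. If `z` is not genuine, nothing moves; if it is
  -- the missing spoke, `gather` takes it to the centre; any other genuine point is taken there by
  -- `contract`.
  contract-hidden-gather : ∀ k i z {w} →
    (Genuine z → w ≡ centre (level z)) → (¬ Genuine z → w ≡ z) →
    contract (hidden k (suc i) (gather (suc i) z)) ≡ hidden k (suc i) w
  contract-hidden-gather k i z {w} w-live w-dead with genuine? z
  ... | no ¬g = begin
    contract (hidden k (suc i) (gather (suc i) z))
      ≡⟨ cong (contract ∘ hidden k (suc i)) (gather-other (¬g ∘ recognised⇒genuine)) ⟩
    contract (hidden k (suc i) z)
      ≡⟨ contract-hidden-dead (¬g ∘ proj₂) ⟩
    hidden k (suc i) z
      ≡⟨ cong (hidden k (suc i)) (w-dead ¬g) ⟨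
    hidden k (suc i) w
      ∎
    where open ≡-Reasoning
  ... | yes g with index z ≟ suc i ⊓ level z
  ... | yes p = begin
    contract (hidden k (suc i) (gather (suc i) z))
      ≡⟨ cong (contract ∘ hidden k (suc i)) (gather-recognised (genuine⇒recognised g p)) ⟩
    contract (hidden k (suc i) (centre (level z)))
      ≡⟨ contract-hidden-centre k (suc i) (level z) ⟩
    hidden k (suc i) (centre (level z))
      ≡⟨ cong (hidden k (suc i)) (w-live g) ⟨
    hidden k (suc i) w
      ∎
    where open ≡-Reasoning
  ... | no p = begin
    contract (hidden k (suc i) (gather (suc i) z))
      ≡⟨ cong (contract ∘ hidden k (suc i)) (gather-other (p ∘ proj₁)) ⟩
    contract (hidden k (suc i) z)
      ≡⟨ contract-hidden-live (flag-zero p) g ⟩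
    ⟨ ⟨ ⟨ k , suc i ⟩ , 0 ⟩ , centre (level z) ⟩
      ≡⟨ cong (λ b → ⟨ ⟨ ⟨ k , suc i ⟩ , b ⟩ , centre (level z) ⟩) (flag-centre g p) ⟨
    ⟨ ⟨ ⟨ k , suc i ⟩ , flag (suc i) (centre (level z)) ⟩ , centre (level z) ⟩
      ≡⟨ hide-pair k (suc i) (centre (level z)) ⟨
    hidden k (suc i) (centre (level z))
      ≡⟨ cong (hidden k (suc i)) (w-live g) ⟨
    hidden k (suc i) w
      ∎
    where open ≡-Reasoning

  -- The right side is an injective function of `contract x`, which gives both directions of the
  -- reduction.
  contract-hide-fold : ∀ i x →
    contract (hide (fold (suc i) x)) ≡
    hide (place (suc i) (fst (contract x)) (snd (contract x)))
  contract-hide-fold i x with snd (fst x) ≟ 0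
  ... | no b = begin
    contract (hide (fold (suc i) x))
      ≡⟨ cong contract (cong₂ (hidden (fst x)) (ifz-nonzero b) (ifz-nonzero b)) ⟩
    contract (hidden (fst x) 0 (snd x))
      ≡⟨ contract-hidden-dead (λ ()) ⟩
    hidden (fst x) 0 (snd x)
      ≡⟨ cong (λ j → hidden (fst x) j (snd x)) (ifz-nonzero b) ⟨
    hide (place (suc i) (fst x) (snd x))
      ≡⟨ cong (λ y → hide (place (suc i) (fst y) (snd y))) (contract-dead (b ∘ proj₁)) ⟨
    hide (place (suc i) (fst (contract x)) (snd (contract x)))
      ∎
    where open ≡-Reasoning
  ... | yes b = begin
    contract (hide (fold (suc i) x))
      ≡⟨ cong contract (cong₂ (hidden (fst x)) (ifz-zero b) (ifz-zero b)) ⟩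
    contract (hidden (fst x) (suc i) (gather (suc i) (snd x)))
      ≡⟨ contract-hidden-gather (fst x) i (snd x)
           (λ g → trans (cong snd (contract-live (b , g))) (snd-pair _ _))
           (λ ¬g → cong snd (contract-dead (¬g ∘ proj₂))) ⟩
    hidden (fst x) (suc i) (snd (contract x))
      ≡⟨ cong (λ j → hidden (fst x) j (snd (contract x))) (ifz-zero b) ⟨
    hide (place (suc i) (fst x) (snd (contract x)))
      ≡⟨ cong (λ k → hide (place (suc i) k (snd (contract x)))) (fst-contract x) ⟨
    hide (place (suc i) (fst (contract x)) (snd (contract x)))
      ∎
    where open ≡-Reasoning

  fold-reduces : ∀ i x y → R x y ⇔ S (fold (suc i) x) (fold (suc i) y)
  fold-reduces i x y = mk⇔
    (λ xRy → trans (contract-hide-fold i x)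
      (trans (cong (λ w → hide (place (suc i) (fst w) (snd w))) xRy)
        (sym (contract-hide-fold i y))))
    (λ eq → let fst≡ , snd≡ = place-injective (hide-injective
                  (trans (sym (contract-hide-fold i x)) (trans eq (contract-hide-fold i y))))
            in fst-snd-injective fst≡ snd≡)

  computes⇒≡ : ∀ {i} → A Computes χ (C (suc i)) → R ≡[ A ] S
  computes⇒≡ {i = i} c =
    (fold (suc i) , computes (foldʳ c (var 0F)) , fold-reduces i) ,
    (hide , computes (hideʳ (var 0F)) , λ x y → mk⇔ id id)

  -- Related points of `S`, and reading an oracle off informative guesses.

  record LivingTwins (u v : ℕ) : Set where
    field
      genuineˡ   : Genuine (snd u)
      genuineʳ   : Genuine (snd v)
      -- This excludes one index, making a star of `S` smaller than the star of `R` at the same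
      -- level.
      kept       : index (snd u) ≢ snd (fst u) ⊓ level (snd u)
      same-copy  : fst u ≡ fst v
      same-level : level (snd u) ≡ level (snd v)

  open LivingTwins

  S⇒twins : ∀ {u v} → S u v → u ≢ v → LivingTwins u v
  S⇒twins {u} {v} uSv u≢v
    with R⇒siblings {hide u} {hide v} uSv (u≢v ∘ hide-injective)
  ... | l , l′ , fst≡ , level≡ = record
    { genuineˡ   = live-hide⇒genuine l
    ; genuineʳ   = live-hide⇒genuine l′
    ; kept       = flag-zero⁻¹ (snd (fst u)) (live-hide⇒flag l)
    ; same-copy  = proj₁ (pair-injective
                     (trans (sym (fst-hide u)) (trans fst≡ (fst-hide v))))
    ; same-level = trans (cong level (sym (snd-hide u)))
                     (trans level≡ (cong level (snd-hide v)))
    }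

  -- Centres are excluded since their prefixes come from `C 0`.
  Informative : ℕ → Set
  Informative z = Genuine z × index z ≢ 0

  module Extraction (em : ExcludedMiddle 0ℓ) where

    dichotomy : (P : ℕ → Set) →
      (∀ N → ∃ λ M → N ≤ M × P M) ⊎ (∃ λ N → ∀ M → N ≤ M → ¬ P M)
    dichotomy P with em {∃ λ N → ∀ M → N ≤ M → ¬ P M}
    ... | yes eventually-not = inj₂ eventually-not
    ... | no  ¬eventually-not = inj₁ frequently
      where
      frequently : ∀ N → ∃ λ M → N ≤ M × P M
      frequently N with em {∃ λ M → N ≤ M × P M}
      ... | yes p = p
      ... | no ¬p = contradiction (N , λ M N≤M PM → ¬p (M , N≤M , PM)) ¬eventually-not

    module _ {A : Oracle} {g : ℕ → ℕ} (g-computable : A Computes g)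
      (g-informative : ∀ M → Informative (g M)) (g-level : ∀ M → M ≤ level (g M)) where

      -- To find `D` at x, search for an M above x that passes the test `T`. The prefix in `g M`
      -- then extends beyond x, and by `sound` its oracle agrees with `D` there.
      read-off : (T : ℕ → ℕ → ℕ) →
        Recursive {2} A (λ xs → T (lookup xs 0F) (lookup xs 1F)) →
        (∀ x → ∃ λ M → (suc x ∸ M) + T M x ≡ 0) →
        (∀ {M x} → T M x ≡ 0 → C (index (g M)) x ≡ D x) →
        A Computes χ D
      read-off {D = D} T Tʳ found sound = computes
        (convʳ correct′ (bitʳ (levelʳ gMʳ) (prefixʳ gMʳ) (var 0F)))
        where
        found′ : (xs : Vec ℕ 1) → ∃ λ M → (suc (lookup xs 0F) ∸ M) + T M (lookup xs 0F) ≡ 0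
        found′ xs = found (lookup xs 0F)
        M : Vec ℕ 1 → ℕ
        M xs = proj₁ (least _ (found′ xs))
        Mʳ : Recursive A M
        Mʳ = searchʳ ((sucʳ (var 1F) ∸ʳ var 0F) +ʳ Tʳ) found′
        gMʳ : Recursive A (λ xs → g (M xs))
        gMʳ = appʳ g-computable Mʳ
        correct′ : ∀ xs → bit (level (g (M xs))) (prefix (g (M xs))) (lookup xs 0F) ≡
                          χ D (lookup xs 0F)
        correct′ xs = begin
          bit (level z) (prefix z) x
            ≡⟨ cong (λ s → bit (level z) s x) (proj₂ (proj₁ (g-informative (M xs)))) ⟩
          bit (level z) (code (C (index z)) (level z)) x
            ≡⟨ bit-code (C (index z)) x<level ⟩
          χ (C (index z)) x
            ≡⟨ cong (if_then 1 else 0) (sound {M xs} (m+n≡0⇒n≡0 (suc x ∸ M xs) zero′)) ⟩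
          χ D x
            ∎
          where
          open ≡-Reasoning
          x = lookup xs 0F
          z = g (M xs)
          zero′ : (suc x ∸ M xs) + T (M xs) x ≡ 0
          zero′ = proj₁ (proj₂ (least _ (found′ xs)))
          x<level : x < level z
          x<level = ≤-trans (m∸n≡0⇒m≤n (m+n≡0⇒m≡0 _ zero′)) (g-level (M xs))

      informative⇒computes : (∃ λ i → A Computes χ (C (suc i))) ⊎ A Computes χ L
      informative⇒computes with em {∃ λ j → ∀ N → ∃ λ M → N ≤ M × index (g M) ≡ j}
      ... | yes (zero  , often) =
        contradiction (proj₂ (proj₂ (often 0))) (proj₂ (g-informative _))
      ... | yes (suc i , often) = inj₁ (i , read-off
        (λ M _ → ∣ index (g M) - suc i ∣)
        ∣ indexʳ (appʳ g-computable (var 0F)) - litʳ (suc i) ∣ʳ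
        (λ x → let M , x<M , eq = often (suc x) in
               M , cong₂ _+_ (m≤n⇒m∸n≡0 x<M) (m≡n⇒∣m-n∣≡0 eq))
        (λ {M} {x} eq → cong (λ j → C j x) (∣m-n∣≡0⇒m≡n eq)))
      ... | no ¬often = inj₂ (read-off
        (λ M x → suc x ∸ index (g M))
        (sucʳ (var 1F) ∸ʳ indexʳ (appʳ g-computable (var 0F)))
        (λ x → let N , x<index = eventually-above x
                   M = N ⊔ suc x in
               M , cong₂ _+_ (m≤n⇒m∸n≡0 (m≤n⊔m N (suc x)))
                             (m≤n⇒m∸n≡0 (x<index M (m≤m⊔n N (suc x)))))
        (λ eq → C→L (m∸n≡0⇒m≤n eq)))
        where
        eventually-not : ∀ j → ∃ λ N → ∀ M → N ≤ M → index (g M) ≢ j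
        eventually-not j with dichotomy (λ M → index (g M) ≡ j)
        ... | inj₁ often = contradiction (j , often) ¬often
        ... | inj₂ never = never
        -- No index recurs forever, so the thresholds for finitely many indices can be combined;
        -- index 0 never occurs.
        eventually-above : ∀ x → ∃ λ N → ∀ M → N ≤ M → x < index (g M)
        eventually-above zero = 0 , λ M _ → n≢0⇒n>0 (proj₂ (g-informative M))
        eventually-above (suc x) with eventually-above x | eventually-not (suc x)
        ... | N , above | N′ , avoid = N ⊔ N′ , λ M le →
          ≤∧≢⇒< (above M (≤-trans (m≤m⊔n N N′) le))
                (≢-sym (avoid M (≤-trans (m≤n⊔m N N′) le)))

    -- Informative guesses from a reduction.

    base : ℕ → ℕ
    base z = ⟨ ⟨ 0 , 0 ⟩ , z ⟩

    baseʳ : Recursive A F → Recursive A (λ xs → base (F xs))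
    baseʳ e = ⟨ litʳ ⟨ 0 , 0 ⟩ , e ⟩ʳ

    base-siblings : ∀ {y z} → Genuine y → Genuine z → level y ≡ level z →
                    R (base y) (base z)
    base-siblings {y} {z} gy gz level≡ = siblings⇒R
      ( live gy , live gz , trans (fst-pair _ _) (sym (fst-pair _ _))
      , trans (cong level (snd-pair _ _)) (trans level≡ (cong level (sym (snd-pair _ _)))))
      where
      live : ∀ {z} → Genuine z → Live (base z)
      live g = trans (cong snd (fst-pair _ _)) (snd-pair _ _) ,
               subst Genuine (sym (snd-pair _ _)) g

    spokes-related : ∀ {j j′ n} → j ≤ n → j′ ≤ n →
                     R (base (spoke j n)) (base (spoke j′ n))
    spokes-related {j} {j′} {n} j≤n j′≤n =
      base-siblings (spoke-genuine j≤n) (spoke-genuine j′≤n)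
        (trans (level-spoke j n) (sym (level-spoke j′ n)))

    module _ {A : Oracle} {f : ℕ → ℕ} (f-computable : A Computes f)
      (f-reduces : ∀ x y → R x y ⇔ S (f x) (f y)) where

      Collapse : ℕ → Set
      Collapse n = ∃₂ λ j j′ → j ≤ n × j′ ≤ n × j ≢ j′ ×
                   f (base (spoke j n)) ≡ f (base (spoke j′ n))

      Sequence : Set
      Sequence = ∃ λ g → A Computes g × (∀ M → Informative (g M)) × (∀ M → M ≤ level (g M))

      -- Genuineness cannot be tested, but it comes for free: two guesses with the same image under
      -- `f` are related in `R`, and distinct related points are live. So it suffices to search for
      -- such a pair.
      collapsing : (∀ N → ∃ λ n → N ≤ n × Collapse n) → Sequence
      collapsing often = g , g-computable , proj₁ ∘ found , proj₂ ∘ found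
        where
        test : ℕ → ℕ → ℕ → ℕ
        -- The term `ifz c 1 0` tests that c is nonzero.
        test y z N = (ifz (index z) 1 0 + (N ∸ level z)) +
                     (ifz ∣ z - y ∣ 1 0 + ∣ f (base z) - f (base y) ∣)
        testʳ : ∀ {F G H : Vec ℕ n → ℕ} → Recursive A F → Recursive A G → Recursive A H →
                Recursive A (λ xs → test (F xs) (G xs) (H xs))
        testʳ y z N =
          (ifzʳ (indexʳ z) (litʳ 1) (litʳ 0) +ʳ (N ∸ʳ levelʳ z)) +ʳ
          (ifzʳ ∣ z - y ∣ʳ (litʳ 1) (litʳ 0) +ʳ
            ∣ appʳ f-computable (baseʳ z) - appʳ f-computable (baseʳ y) ∣ʳ)
        pick : ∀ {j j′ n N} → N ≤ n → j ≢ 0 → j ≢ j′ →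
               f (base (spoke j n)) ≡ f (base (spoke j′ n)) →
               ∃ λ u → test (fst u) (snd u) N ≡ 0
        pick {j} {j′} {n} {N} N≤n j≢0 j≢j′ eq = ⟨ spoke j′ n , spoke j n ⟩ ,
          trans (cong₂ (λ y z → test y z N) (fst-pair _ _) (snd-pair _ _))
            (cong₂ _+_
              (cong₂ _+_ (ifz-nonzero (j≢0 ∘ trans (sym (index-spoke j n))))
                         (m≤n⇒m∸n≡0 (subst (N ≤_) (sym (level-spoke j n)) N≤n)))
              (cong₂ _+_ (ifz-nonzero (j≢j′ ∘ spoke-injective ∘ ∣m-n∣≡0⇒m≡n))
                         (m≡n⇒∣m-n∣≡0 eq)))
          where
          spoke-injective : spoke j n ≡ spoke j′ n → j ≡ j′
          spoke-injective e =
            trans (sym (index-spoke j n)) (trans (cong index e) (index-spoke j′ n))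
        witness : ∀ N → ∃ λ u → test (fst u) (snd u) N ≡ 0
        witness N with often N
        -- Of two distinct indices one is nonzero; its spoke plays the part of `z` in the test.
        ... | _ , _   , zero  , zero   , _ , _ , 0≢0  , _  = contradiction refl 0≢0
        ... | _ , N≤n , suc j , j′     , _ , _ , j≢j′ , eq = pick N≤n (λ ()) j≢j′ eq
        ... | _ , N≤n , zero  , suc j′ , _ , _ , j≢j′ , eq =
          pick N≤n (λ ()) (≢-sym j≢j′) (sym eq)
        u : ℕ → ℕ
        u N = proj₁ (least _ (witness N))
        g : ℕ → ℕ
        g N = snd (u N)
        g-computable : A Computes g
        g-computable = computes (sndʳ (searchʳ
          (testʳ (fstʳ (var 0F)) (sndʳ (var 0F)) (var 1F)) (λ xs → witness (lookup xs 0F))))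
        found : ∀ N → Informative (g N) × N ≤ level (g N)
        found N = (genuine , index≢0) ,
                  m∸n≡0⇒m≤n (m+n≡0⇒n≡0 (ifz (index (g N)) 1 0) zeroˡ)
          where
          zero′ : test (fst (u N)) (g N) N ≡ 0
          zero′ = proj₁ (proj₂ (least _ (witness N)))
          zeroˡ = m+n≡0⇒m≡0 _ zero′
          zeroʳ = m+n≡0⇒n≡0 (ifz (index (g N)) 1 0 + (N ∸ level (g N))) zero′
          ifz-test : ∀ {c} → ifz c 1 0 ≡ 0 → c ≢ 0
          ifz-test eq c≡0 = 0≢1+n (trans (sym eq) (ifz-zero c≡0))
          index≢0 : index (g N) ≢ 0
          index≢0 = ifz-test (m+n≡0⇒m≡0 _ zeroˡ)
          distinct : g N ≢ fst (u N)
          distinct = ifz-test (m+n≡0⇒m≡0 _ zeroʳ) ∘ m≡n⇒∣m-n∣≡0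
          collapsed : f (base (g N)) ≡ f (base (fst (u N)))
          collapsed = ∣m-n∣≡0⇒m≡n (m+n≡0⇒n≡0 (ifz ∣ g N - fst (u N) ∣ 1 0) zeroʳ)
          genuine : Genuine (g N)
          genuine = subst Genuine (snd-pair _ _) (proj₂ (proj₁ (R⇒siblings
            (Equivalence.from (f-reduces _ _) (cong (contract ∘ hide) collapsed))
            (distinct ∘ proj₂ ∘ pair-injective))))

      -- The level is a successor so that the centre has another point to be compared with.
      module Star (n : ℕ) (injective : ¬ Collapse (suc n)) where

        image : ℕ → ℕ
        image j = f (base (spoke j (suc n)))

        images-distinct : ∀ {j j′} → j ≤ suc n → j′ ≤ suc n → j ≢ j′ → image j ≢ image j′
        images-distinct j≤ j′≤ j≢j′ eq = injective (_ , _ , j≤ , j′≤ , j≢j′ , eq)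

        twins : ∀ {j j′} → j ≤ suc n → j′ ≤ suc n → j ≢ j′ → LivingTwins (image j) (image j′)
        twins j≤ j′≤ j≢j′ = S⇒twins
          (Equivalence.to (f-reduces _ _) (spokes-related j≤ j′≤)) (images-distinct j≤ j′≤ j≢j′)

        -- All images are genuine, in one copy and at one level, so only their indices can tell them
        -- apart.
        index-determines : ∀ {j j′} → j ≤ suc n → j′ ≤ suc n →
                           index (snd (image j)) ≡ index (snd (image j′)) → j ≡ j′
        index-determines {j} {j′} j≤ j′≤ eq with j ≟ j′
        ... | yes j≡j′ = j≡j′
        ... | no  j≢j′ = contradiction
          (fst-snd-injective (same-copy t) (trans (genuine-spoke (genuineˡ t))
            (trans (cong₂ spoke eq (same-level t)) (sym (genuine-spoke (genuineʳ t))))))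
          (images-distinct j≤ j′≤ j≢j′)
          where t = twins j≤ j′≤ j≢j′

        copy target : ℕ
        copy   = snd (fst (image 0))
        target = level (snd (image 0))

        record Landing (j : ℕ) : Set where
          field
            genuine  : Genuine (snd (image j))
            avoiding : index (snd (image j)) ≢ copy ⊓ target
            landing  : level (snd (image j)) ≡ target

        open Landing

        lands : ∀ {j} → j ≤ suc n → Landing j
        lands {zero}  _  = record
          { genuine = genuineˡ t ; avoiding = kept t ; landing = refl }
          where t = twins z≤n (s≤s z≤n) (λ ())
        lands {suc j} j≤ = record
          { genuine  = genuineˡ t
          ; avoiding = λ eq → kept t (trans eq
              (sym (cong₂ _⊓_ (cong snd (same-copy t)) (same-level t))))
          ; landing  = same-level t
          }
          where t = twins j≤ z≤n (λ ())

        -- Pigeonhole: the n + 2 points of the star get distinct indices between 0 and `target`,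
        -- none of which is the missing one; so n + 2 is at most `target`.
        level-rises : suc n < target
        level-rises = injective⇒≤ {f = λ i → punchOut (hole≢slot i)}
          λ {i} {i′} eq → toℕ-injective (index-determines (bounded i) (bounded i′)
            (fromℕ<-injective _ _ (slot< i) (slot< i′)
              (punchOut-injective (hole≢slot i) (hole≢slot i′) eq)))
          where
          bounded : (i : Fin (2 + n)) → toℕ i ≤ suc n
          bounded i = s≤s⁻¹ (toℕ<n i)
          slot< : ∀ i → index (snd (image (toℕ i))) < suc target
          slot< i = s≤s (subst (index (snd (image (toℕ i))) ≤_) (landing l) (proj₁ (genuine l)))
            where l = lands (bounded i)
          hole≢slot : ∀ i → fromℕ< (s≤s (m⊓n≤n copy target)) ≢ fromℕ< (slot< i)
          hole≢slot i eq = avoiding (lands (bounded i))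
            (sym (fromℕ<-injective _ _ (s≤s (m⊓n≤n copy target)) (slot< i) eq))

      -- If the image of `z` has index 0, it is of no use; then the image of the centre of the same
      -- star has another index and takes its place.
      step : ℕ → ℕ
      step z = ifz (index (snd (f (base z))))
                   (snd (f (base (centre (level z))))) (snd (f (base z)))

      step-informative : ∀ {z} → ¬ Collapse (level z) → Informative z →
                         Informative (step z) × level z < level (step z)
      step-informative {z} injective (g , index≢0) = go (index z) (level z)
        (genuine-spoke g) index≢0 (proj₁ g) injective
        where
        -- As `j` is nonzero and at most `n`, also `n` is a successor, as `Star` requires.
        go : ∀ {z} j n → z ≡ spoke j n → j ≢ 0 → j ≤ n → ¬ Collapse n →
             Informative (step z) × n < level (step z)
        go zero    _       _    0≢0 _ _   = contradiction refl 0≢0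
        go (suc j) (suc n) refl _   j≤n injective =
          subst (λ l → Good (ifz (index (snd (image (suc j))))
                                 (snd (f (base (centre l)))) (snd (image (suc j)))))
            (sym (level-spoke (suc j) (suc n))) chosen
          where
          open Star n injective
          open Landing
          Good : ℕ → Set
          Good w = Informative w × suc n < level w
          rises : ∀ {j} → j ≤ suc n → suc n < level (snd (image j))
          rises j≤ = subst (suc n <_) (sym (landing (lands j≤))) level-rises
          chosen : Good (ifz (index (snd (image (suc j)))) (snd (image 0)) (snd (image (suc j))))
          chosen with index (snd (image (suc j))) ≟ 0
          ... | no  i≢0 = subst Good (sym (ifz-nonzero i≢0))
            ((genuine (lands j≤n) , i≢0) , rises j≤n)
          ... | yes i≡0 = subst Good (sym (ifz-zero i≡0))
            ( (genuine (lands z≤n)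
              , λ eq → 1+n≢0 (index-determines j≤n z≤n (trans i≡0 (sym eq))))
            , rises z≤n)

      rising : (∃ λ N → ∀ n → N ≤ n → ¬ Collapse n) → Sequence
      rising (N , injective) = g ,
        -- The starting guess is a single number, so it can be built into the program whatever
        -- oracle it describes.
        computes (natrecʳ (litʳ (spoke 1 (suc N)))
          (ifzʳ (indexʳ (sndʳ (fʳ (var 1F)))) (sndʳ (fʳ (centreʳ (levelʳ (var 1F)))))
            (sndʳ (fʳ (var 1F)))) (var 0F)) ,
        proj₁ ∘ invariant , λ M → ≤-trans (m≤m+n M N) (proj₂ (invariant M))
        where
        fʳ : ∀ {F : Vec ℕ n → ℕ} → Recursive A F → Recursive A (λ xs → f (base (F xs)))
        fʳ e = appʳ f-computable (baseʳ e)
        g : ℕ → ℕ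
        g = natrec (spoke 1 (suc N)) (λ _ → step)
        -- The summand `N` keeps the iteration at levels where no star collapses.
        invariant : ∀ M → Informative (g M) × M + N ≤ level (g M)
        invariant zero    =
          (spoke-genuine (s≤s z≤n) , λ eq → 1+n≢0 (trans (sym (index-spoke 1 (suc N))) eq)) ,
          subst (N ≤_) (sym (level-spoke 1 (suc N))) (n≤1+n N)
        invariant (suc M) with invariant M
        ... | inf , M+N≤ with step-informative (injective _ (≤-trans (m≤n+m N M) M+N≤)) inf
        ... | inf′ , rises = inf′ , ≤-trans (s≤s M+N≤) rises

    ≤⇒computes : R ≤[ A ] S → (∃ λ i → A Computes χ (C (suc i))) ⊎ A Computes χ L
    ≤⇒computes (f , f-computable , f-reduces)
      with [ collapsing f-computable f-reduces , rising f-computable f-reduces ]′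
             (dichotomy (Collapse f-computable f-reduces))
    ... | _ , g-computable , g-informative , g-level =
      informative⇒computes g-computable g-informative g-level

-- Arbitrary sequences of oracles.

-- Finitely many values of each B i are changed, so that the oracles converge to B 0
-- and a code of an initial segment also describes B 0 up to the index.
module Splice (B : ℕ → Oracle) where

  splice : ℕ → Oracle
  splice zero    _ = false
  splice (suc i) x = if does (x <? suc i) then B 0 x else B i x

  splice-below : ∀ {i x} → x < i → splice i x ≡ B 0 x
  splice-below {suc i} {x} x<i
    rewrite dec-true (x <? suc i) x<i = refl

  splice-above : ∀ i x → suc i ≤ x → splice (suc i) x ≡ B i x
  splice-above i x i<x
    rewrite dec-false (x <? suc i) (≤⇒≯ i<x) = refl

  splice₀-computable : A Computes χ (splice 0)
  splice₀-computable = computes (litʳ 0)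

  B⇒splice : ∀ i → A Computes χ (B i) → A Computes χ (splice (suc i))
  B⇒splice i = Computes-ext (suc i) λ x i<x →
    cong (if_then 1 else 0) (sym (splice-above i x i<x))

  splice⇒B : ∀ i → A Computes χ (splice (suc i)) → A Computes χ (B i)
  splice⇒B i = Computes-ext (suc i) λ x i<x →
    cong (if_then 1 else 0) (splice-above i x i<x)

  open Construction splice (B 0) splice-below splice₀-computable public

  spectrum : ExcludedMiddle 0ℓ → ∀ d → (R ≡[ d ] S) ⇔ (∃ λ i → B i ≤T d)
  spectrum em d = mk⇔ to λ (i , B≤d) → computes⇒≡ (B⇒splice i B≤d)
    where
    to : R ≡[ d ] S → ∃ λ i → B i ≤T d
    to (R≤S , _) with Extraction.≤⇒computes em R≤S
    ... | inj₁ (i , c) = i , splice⇒B i c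
    -- The limit is `B 0`, which itself belongs to the sequence.
    ... | inj₂ c       = 0 , c

-- From a countable basis to a sequence, and the theorem.

sequence : ∀ {b} {ℬ : Degrees b} → Satisfiable (members ℬ) → Countable ℬ →
  ∃ λ (B : ℕ → ∃ (members ℬ)) → ∀ {a} → a ∈ members ℬ → ∃ λ i → proj₁ (B i) ≤T a
sequence _ (inj₂ (B , _ , surjective)) = B , λ {a} a∈ℬ →
  let i , hits = surjective (a , a∈ℬ) in i , proj₁ (hits refl)
sequence (a , a∈ℬ) (inj₁ (zero , B , _ , surjective)) with surjective (a , a∈ℬ)
... | () , _
sequence {ℬ = ℬ} _ (inj₁ (suc n , B , _ , surjective)) = B ∘ clamp , λ {a} a∈ℬ →
  let i , hits = surjective (a , a∈ℬ) in toℕ i , proj₁ (hits (clamp-toℕ i))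
  where
  -- A finite enumeration is continued by repeating its last entry.
  clamp : ℕ → Fin (suc n)
  clamp k = fromℕ< (s≤s (m⊓n≤n k n))
  clamp-toℕ : ∀ i → clamp (toℕ i) ≡ i
  clamp-toℕ i = toℕ-injective (trans (toℕ-fromℕ< _) (m≤n⇒m⊓n≡m (s≤s⁻¹ (toℕ<n i))))

theorem5p1 : ExcludedMiddle 0ℓ →
    ∀ {a b} (𝒜 : Degrees a) (ℬ : Degrees b) →
    Satisfiable (members 𝒜) →
    UpwardClosed 𝒜 →
    IsBasis ℬ 𝒜 →
    Countable ℬ →
    ∃₂ λ (R S : Rel ℕ 0ℓ) →
    IsEquivalence R × IsEquivalence S ×
    (¬ HasInfiniteClass R) × (¬ HasInfiniteClass S) ×
    (members (DgSp⇔ R S) ≐ members 𝒜)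
theorem5p1 em 𝒜 ℬ (a , a∈𝒜) _ basis countable =
  R , S , R-isEquivalence , S-isEquivalence ,
  finite R-class-bounded , finite S-class-bounded ,
  (λ {d} R≡S → let i , Bᵢ≤d = Equivalence.to (spectrum em d) R≡S in
               proj₂ generates (proj₁ (B i) , proj₂ (B i) , Bᵢ≤d)) ,
  (λ {d} d∈𝒜 → let b , b∈ℬ , b≤d = proj₁ generates d∈𝒜
                   i , Bᵢ≤b      = B-exhausts b∈ℬ in
               Equivalence.from (spectrum em d) (i , ≤T-trans Bᵢ≤b b≤d))
  where
  open IsBasis basis
  ℬ-satisfiable : Satisfiable (members ℬ)
  ℬ-satisfiable = let b , b∈ℬ , _ = proj₁ generates a∈𝒜 in b , b∈ℬ
  B          = proj₁ (sequence {ℬ = ℬ} ℬ-satisfiable countable)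
  B-exhausts = proj₂ (sequence {ℬ = ℬ} ℬ-satisfiable countable)
  open Splice (proj₁ ∘ B)
  finite : ∀ {Q : Rel ℕ 0ℓ} → (∀ x → ∃ λ M → ∀ {y} → Q x y → y < M) → ¬ HasInfiniteClass Q
  finite bounded (x , infinite) with bounded x
  ... | M , below = infinite (M , λ y M≤y Qxy → <⇒≱ (below Qxy) M≤y)
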